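{- Let $q$ be a prime power and let $n\geq 2$ be an integer. The number of distance vectors in $\mathcal{D}(n)$ corresponding to pairs of disjoint flags, that is, the cardinality of $\{\mathbf{d}(\mathcal{F},\mathcal{F}')\mid \mathcal{F},\mathcal{F}'\in\mathcal{F}_q(n) \text{ disjoint}\}$, is $E_n=M_{n-2}$, where $M_m$ denotes the $m$-th Motzkin number.
   Context: Let $\mathbb{F}_q$ be the finite field with $q$ elements. A full flag on $\mathbb{F}_q^n$ is a sequence $\mathcal{F}=(\mathcal{F}_1,\dots,\mathcal{F}_{n-1})$ of $\mathbb{F}_q$-subspaces of $\mathbb{F}_q^n$ with $\mathcal{F}_1\subsetneq\cdots\subsetneq\mathcal{F}_{n-1}$ and $\dim \mathcal{F}_i=i$ for every $i$; the set of all full flags is the full flag variety $\mathcal{F}_q(n)$. For subspaces $\mathcal{U},\mathcal{V}$ of the same dimension $k$, the injection distance is $d_I(\mathcal{U},\mathcal{V})=k-\dim(\mathcal{U}\cap\mathcal{V})$. The distance vector of $\mathcal{F},\mathcal{F}'\in\mathcal{F}_q(n)$ is $\mathbf{d}(\mathcal{F},\mathcal{F}')=(d_I(\mathcal{F}_1,\mathcal{F}'_1),\dots,d_I(\mathcal{F}_{n-1},\mathcal{F}'_{n-1}))\in\mathbb{Z}^{n-1}$, and $\mathcal{D}(n)=\{\mathbf{d}(\mathcal{F},\mathcal{F}') \mid \mathcal{F},\mathcal{F}'\in\mathcal{F}_q(n)\}$. Two different full flags $\mathcal{F},\mathcal{F}'$ are disjoint if $\mathcal{F}_i\neq\mathcal{F}'_i$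 for every $1\leq i\leq n-1$. The Motzkin numbers are given by $M_0=1$ and $M_n=M_{n-1}+\sum_{k=0}^{n-2}M_kM_{n-k-2}$ for $n\geq 1$ (the sum being empty for $n=1$); $M_n$ is the number of lattice paths from $(0,0)$ to $(n,0)$ with steps $(1,1)$, $(1,-1)$, $(1,0)$ that never run below the $x$-axis. The numbers $E_n$ are defined by $E_0=E_1=0$ and $E_n=M_{n-2}$ for $n\geq 2$; for $n\geq 2$, $E_n$ is the number of such paths of length $n$ touching the $x$-axis only at $(0,0)$ and $(n,0)$. -}

module Defs where

open import Algebra.Apartness.Bundles using (HeytingField)
open import Algebra.Bundles using (CommutativeRing)
open import Data.Fin.Base as Fin using (Fin; toℕ)
open import Data.Integer.Base as ℤ using (ℤ; +_)
open import Data.List.Base using (List; []; _∷_; reverse; sum; zipWith; applyUpTo; applyDownFrom)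
open import Data.List.Properties using (reverse-applyDownFrom)
open import Data.Nat.Base using (ℕ; zero; suc; _+_; _*_; _∸_; _^_; _≤_)
open import Data.Nat.Primality using (Prime)
open import Data.Product.Base using (Σ; ∃; ∃₂; _×_; _,_; proj₁; proj₂; zip)
open import Data.Vec.Base using (Vec; lookup)
open import Data.Vec.Functional using (Vector)
import Algebra.Properties.CommutativeMonoid.Sum as FieldSum
import Data.Vec.Functional.Relation.Binary.Equality.Setoid as VectorEquality
open import Function.Base using (_∘_)
open import Function.Bundles using (Bijection)
open import Level using (Level; _⊔_) renaming (suc to lsuc; zero to 0ℓ)
open import Relation.Binary.Bundles using (Setoid)
import Relation.Binary.Construct.On as On
open import Relation.Binary.PropositionalEquality.Core using (_≡_; refl; sym; trans; cong; cong₂)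
open import Relation.Binary.PropositionalEquality.Properties using (setoid)
open import Relation.Nullary.Negation using (¬_)
open import Relation.Unary using (Pred; _⊂_; _≐_; _∩_)

IsPrimePower : ℕ → Set
IsPrimePower q = ∃₂ λ p k → Prime p × 1 ≤ k × q ≡ p ^ k

HasCardinality : {a ℓ : Level} → Setoid a ℓ → ℕ → Set (a ⊔ ℓ)
HasCardinality S m = Bijection (setoid (Fin m)) S

-- A subset of A, as the set of those a satisfying P: proofs of P are ignored
-- when comparing elements.
subsetSetoid : {a p : Level} {A : Set a} → Pred A p → Setoid (a ⊔ p) a
subsetSetoid {A = A} P = On.setoid {B = Σ A P} (setoid A) proj₁

-- The recurrence refers to all earlier values, so the value at n is computed
-- from the list M (n - 1) ∷ … ∷ M 0; `M-suc` is the usual recurrence.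

nextMotzkin : List ℕ → ℕ
nextMotzkin []       = 1
nextMotzkin (m ∷ ms) = m + sum (zipWith _*_ (reverse ms) ms)

motzkinsBelow : ℕ → List ℕ
motzkinsBelow zero    = []
motzkinsBelow (suc n) = nextMotzkin (motzkinsBelow n) ∷ motzkinsBelow n

M : ℕ → ℕ
M n = nextMotzkin (motzkinsBelow n)

M-zero : M 0 ≡ 1
M-zero = refl

M-suc : ∀ n → M (suc n) ≡ M n + sum (applyUpTo (λ k → M k * M (n ∸ suc k)) n)
M-suc n = cong (λ xs → M n + sum xs)
  (trans (cong₂ (zipWith _*_)
           (trans (cong reverse (below≡ n)) (reverse-applyDownFrom M n))
           (trans (below≡ n) (downFrom≡upTo M n)))
         (zipWith-applyUpTo M (λ k → M (n ∸ suc k)) n))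
  where
  below≡ : ∀ i → motzkinsBelow i ≡ applyDownFrom M i
  below≡ zero    = refl
  below≡ (suc i) = cong (M i ∷_) (below≡ i)

  downFrom≡upTo : ∀ (f : ℕ → ℕ) i → applyDownFrom f i ≡ applyUpTo (λ k → f (i ∸ suc k)) i
  downFrom≡upTo f zero    = refl
  downFrom≡upTo f (suc i) = cong (f i ∷_) (downFrom≡upTo f i)

  zipWith-applyUpTo : ∀ (f g : ℕ → ℕ) i →
    zipWith _*_ (applyUpTo f i) (applyUpTo g i) ≡ applyUpTo (λ k → f k * g k) i
  zipWith-applyUpTo f g zero    = refl
  zipWith-applyUpTo f g (suc i) = cong (f 0 * g 0 ∷_) (zipWith-applyUpTo (f ∘ suc) (g ∘ suc) i)

E : ℕ → ℕ
E 0             = 0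
E 1             = 0
E (suc (suc n)) = M n

-- On a field with finitely many elements equality and invertibility are
-- decidable, so there a Heyting field is just a field in the usual sense.

module Flags {c ℓ₁ ℓ₂ : Level} (F : HeytingField c ℓ₁ ℓ₂) where

  open HeytingField F using (Carrier; _≈_; 0#)
    renaming (setoid to F-setoid; _+_ to _+F_; _*_ to _*F_)

  private
    F-ring : CommutativeRing c ℓ₁
    F-ring = record { isCommutativeRing = HeytingField.isCommutativeRing F }

  open VectorEquality F-setoid using (_≋_)
  open FieldSum (CommutativeRing.+-commutativeMonoid F-ring) using () renaming (sum to ΣF)

  infixl 6 _+ᵛ_
  infixr 7 _*ᵛ_

  _+ᵛ_ : {n : ℕ} → Vector Carrier n → Vector Carrier n → Vector Carrier n
  (v +ᵛ w) j = v j +F w j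

  _*ᵛ_ : {n : ℕ} → Carrier → Vector Carrier n → Vector Carrier n
  (a *ᵛ v) j = a *F v j

  0ᵛ : {n : ℕ} → Vector Carrier n
  0ᵛ _ = 0#

  combination : {n k : ℕ} → Vector Carrier k → Vector (Vector Carrier n) k → Vector Carrier n
  combination a b j = ΣF (λ i → (a i *ᵛ b i) j)

  record Subspace (n : ℕ) : Set (lsuc (c ⊔ ℓ₁)) where
    field
      Member    : Pred (Vector Carrier n) (c ⊔ ℓ₁)
      respects  : ∀ {v w} → v ≋ w → Member v → Member w
      0-closed  : Member 0ᵛ
      +-closed  : ∀ {v w} → Member v → Member w → Member (v +ᵛ w)
      *-closed  : ∀ a {v} → Member v → Member (a *ᵛ v)

  open Subspace public

  infix  4 _≈ₛ_ _⊊_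
  infixl 7 _∩ₛ_

  _≈ₛ_ : {n : ℕ} → Subspace n → Subspace n → Set (c ⊔ ℓ₁)
  U ≈ₛ V = Member U ≐ Member V

  _⊊_ : {n : ℕ} → Subspace n → Subspace n → Set (c ⊔ ℓ₁)
  U ⊊ V = Member U ⊂ Member V

  _∩ₛ_ : {n : ℕ} → Subspace n → Subspace n → Subspace n
  U ∩ₛ V = record
    { Member   = Member U ∩ Member V
    ; respects = λ v≋w → λ (u , v) → respects U v≋w u , respects V v≋w v
    ; 0-closed = 0-closed U , 0-closed V
    ; +-closed = zip (+-closed U) (+-closed V)
    ; *-closed = λ a → λ (u , v) → *-closed U a u , *-closed V a v
    }

  LinearlyIndependent : {n k : ℕ} → Vector (Vector Carrier n) k → Set (c ⊔ ℓ₁)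
  LinearlyIndependent b = ∀ a → combination a b ≋ 0ᵛ → ∀ i → a i ≈ 0#

  record IsBasis {n k : ℕ} (U : Subspace n) (b : Vector (Vector Carrier n) k) : Set (c ⊔ ℓ₁) where
    field
      members     : ∀ i → Member U (b i)
      independent : LinearlyIndependent b
      spanning    : ∀ {v} → Member U v → ∃ λ a → v ≋ combination a b

  -- Dimension and the quantities derived from it are given by their graphs,
  -- since a dimension cannot be computed from a membership predicate alone.

  HasDimension : {n : ℕ} → Subspace n → ℕ → Set (c ⊔ ℓ₁)
  HasDimension {n} U k = ∃ λ (b : Vector (Vector Carrier n) k) → IsBasis U b

  -- The entry at i : Fin (n ∸ 1) is the subspace of dimension 1 + i.
  record Flag (n : ℕ) : Set (lsuc (c ⊔ ℓ₁)) where
    field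
      space     : Fin (n ∸ 1) → Subspace n
      chain     : ∀ {i j} → i Fin.< j → space i ⊊ space j
      dimension : ∀ i → HasDimension (space i) (suc (toℕ i))

  open Flag public

  _≈ᶠ_ : {n : ℕ} → Flag n → Flag n → Set (c ⊔ ℓ₁)
  𝓕 ≈ᶠ 𝓖 = ∀ i → space 𝓕 i ≈ₛ space 𝓖 i

  Disjoint : {n : ℕ} → Flag n → Flag n → Set (c ⊔ ℓ₁)
  Disjoint 𝓕 𝓖 = ¬ (𝓕 ≈ᶠ 𝓖) × (∀ i → ¬ (space 𝓕 i ≈ₛ space 𝓖 i))

  -- d_I(U , V) = d, for subspaces U and V of dimension k.
  InjectionDistance : {n : ℕ} → ℕ → Subspace n → Subspace n → ℤ → Set (c ⊔ ℓ₁)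
  InjectionDistance k U V d = ∃ λ m → HasDimension (U ∩ₛ V) m × d ≡ (+ k) ℤ.- (+ m)

  DistanceVector : {n : ℕ} → Flag n → Flag n → Vec ℤ (n ∸ 1) → Set (c ⊔ ℓ₁)
  DistanceVector 𝓕 𝓖 d =
    ∀ i → InjectionDistance (suc (toℕ i)) (space 𝓕 i) (space 𝓖 i) (lookup d i)

  IsDisjointDistanceVector : (n : ℕ) → Pred (Vec ℤ (n ∸ 1)) (lsuc (c ⊔ ℓ₁))
  IsDisjointDistanceVector n d =
    ∃₂ λ (𝓕 𝓖 : Flag n) → Disjoint 𝓕 𝓖 × DistanceVector 𝓕 𝓖 d

  disjointDistanceVectors : (n : ℕ) → Setoid (lsuc (c ⊔ ℓ₁)) 0ℓ
  disjointDistanceVectors n = subsetSetoid (IsDisjointDistanceVector n)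

{-# OPTIONS --safe #-}
-- Write the distance vector of two disjoint full flags as (1 + h₁ , … , 1 + hₙ₋₁).
-- Then h is the height sequence of a Motzkin path of length n - 2, and every such
-- path occurs.  For the first claim, compare U ∩ V with U′ ∩ V′ when U ⊆ U′ and
-- V ⊆ V′ have codimension 1: counting vectors over 𝔽_q shows that the dimension
-- grows by at most 2, so the distance changes by at most 1.  Taking U′ = V′ = 𝔽_qⁿ
-- bounds the last distance by 1.  For the second claim, coordinate subspaces suffice:
-- the two subsets of coordinates both gain the same new element (level step),
-- gain distinct new elements (up), or each gains an element of the other (down).
module Submission where

open import Defs
open import Algebra.Apartness.Bundles using (HeytingField)
open import Algebra.Bundles using (CommutativeRing)
import Algebra.Properties.CommutativeMonoid.Sum as Sum
import Algebra.Properties.Ring as RingProperties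
open import Data.Bool.Base using (Bool; true; false; _∧_; if_then_else_)
import Data.Bool.Properties as Bool
open import Data.Fin.Base
  using (Fin; zero; suc; toℕ; inject₁; fromℕ; combine; remQuot; punchOut; finToFun; funToFin)
import Data.Fin.Properties as Fin
open import Data.Fin.Subset using (Subset; inside; outside; _∉_; _⊆_; ∣_∣; ⊤)
  renaming (_∩_ to _∩ˢ_)
open import Data.Fin.Subset.Properties
  using (⊆-refl; ⊆-trans; _∈?_; x∈p∩q⁺; x∈p∩q⁻; ∣⊤∣≡n; ∈⊤)
open import Data.Integer.Base using (ℤ; _-_; _⊖_) renaming (+_ to pos)
import Data.Integer.Properties as ℤ
open import Data.List.Base using (applyUpTo)
open import Data.Nat.Base
  using (ℕ; zero; suc; _+_; _*_; _∸_; _^_; _≤_; _<_; z≤n; s≤s; s≤s⁻¹; >-nonZero; nonTrivial⇒n>1)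
open import Data.Nat.Induction using (<-rec)
open import Data.Nat.ListAction using (sum)
open import Data.Nat.Primality using (prime⇒nonTrivial)
open import Data.Nat.Properties
open import Algebra.Properties.CommutativeSemigroup +-commutativeSemigroup
  using (interchange; x∙yz≈y∙xz)
open import Data.Product.Base using (∃-syntax; _×_; _,_; proj₁; proj₂)
open import Data.Product.Properties using (≡-dec)
open import Data.Sum.Base using (inj₁; inj₂)
open import Data.Sum.Function.Propositional using (_⊎-↔_)
open import Data.Vec.Base using (Vec; []; _∷_; lookup; tabulate; map; replicate; here; there)
open import Data.Vec.Functional using (Vector)
import Data.Vec.Functional.Relation.Binary.Equality.Setoid as VectorEquality
open import Data.Vec.Properties using (lookup∘tabulate; tabulate-cong; tabulate∘lookup)
open import Function.Base using (_∘_; id)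
open import Function.Bundles using (Bijection; Inverse; _↔_; mk↔ₛ′)
open import Function.Construct.Composition using (_↔-∘_)
open import Function.Definitions using (Injective)
open import Level using (Level; Lift; lift; lower; _⊔_)
open import Relation.Binary.Definitions using (DecidableEquality)
open import Relation.Binary.PropositionalEquality.Core
  using (_≡_; _≢_; refl; sym; trans; cong; cong₂; subst; subst₂)
open import Relation.Binary.PropositionalEquality.Properties using (module ≡-Reasoning)
open import Relation.Nullary.Decidable using (Dec; yes; no; does)
open import Relation.Nullary.Negation using (¬_; contradiction)

-- Counting Motzkin paths

-- Paths of `m` steps from height `h` to height 0 that never go below 0, counted by their first
-- step. The starting height has to vary for this recursion.
#paths : ℕ → ℕ → ℕ
#paths zero    zero    = 1
#paths (suc h) zero    = 0
#paths zero    (suc m) = #paths 0 m + #paths 1 m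
#paths (suc h) (suc m) = #paths h m + (#paths (suc h) m + #paths (suc (suc h)) m)

sum-applyUpTo-cong : ∀ {f g : ℕ → ℕ} m → (∀ {k} → k < m → f k ≡ g k) →
  sum (applyUpTo f m) ≡ sum (applyUpTo g m)
sum-applyUpTo-cong zero    f≗g = refl
sum-applyUpTo-cong (suc m) f≗g =
  cong₂ _+_ (f≗g (s≤s z≤n)) (sum-applyUpTo-cong m (f≗g ∘ s≤s))

sum-applyUpTo-+ : ∀ (f g : ℕ → ℕ) m →
  sum (applyUpTo (λ k → f k + g k) m) ≡ sum (applyUpTo f m) + sum (applyUpTo g m)
sum-applyUpTo-+ f g zero    = refl
sum-applyUpTo-+ f g (suc m) = begin
  f 0 + g 0 + sum (applyUpTo (λ k → f (suc k) + g (suc k)) m)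
    ≡⟨ cong (f 0 + g 0 +_) (sum-applyUpTo-+ (f ∘ suc) (g ∘ suc) m) ⟩
  f 0 + g 0 + (sum (applyUpTo (f ∘ suc) m) + sum (applyUpTo (g ∘ suc) m))
    ≡⟨ interchange (f 0) (g 0) _ _ ⟩
  f 0 + sum (applyUpTo (f ∘ suc) m) + (g 0 + sum (applyUpTo (g ∘ suc) m)) ∎
  where open ≡-Reasoning

-- The `suc` in `m ∸ suc k` pays for the down step between the two factors; with both functions
-- equal to `M` this is the sum in `M-suc`.
convolution : (ℕ → ℕ) → (ℕ → ℕ) → ℕ → ℕ
convolution f g m = sum (applyUpTo (λ k → f k * g (m ∸ suc k)) m)

convolution-distribʳ-+ : ∀ f f′ g m →
  convolution (λ k → f k + f′ k) g m ≡ convolution f g m + convolution f′ g m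
convolution-distribʳ-+ f f′ g m = trans
  (sum-applyUpTo-cong m (λ {k} _ → *-distribʳ-+ (g (m ∸ suc k)) (f k) (f′ k)))
  (sum-applyUpTo-+ (λ k → f k * g (m ∸ suc k)) (λ k → f′ k * g (m ∸ suc k)) m)

-- The terms count the paths by their first visit to height 0; expanding the first
-- step of #paths h reduces the identity to shorter paths.
#paths-convolution : ∀ h m → convolution (#paths h) (#paths 0) m ≡ #paths (suc h) m
#paths-convolution h       zero    = refl
-- The term `k = 0` is `1 * #paths 0 m`: the path steps down at once.
#paths-convolution zero    (suc m) = cong₂ _+_ (+-identityʳ (#paths 0 m)) (begin
  convolution (λ k → #paths 0 k + #paths 1 k) (#paths 0) m
    ≡⟨ convolution-distribʳ-+ (#paths 0) (#paths 1) (#paths 0) m ⟩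
  convolution (#paths 0) (#paths 0) m + convolution (#paths 1) (#paths 0) m
    ≡⟨ cong₂ _+_ (#paths-convolution 0 m) (#paths-convolution 1 m) ⟩
  #paths 1 m + #paths 2 m ∎)
  where open ≡-Reasoning
-- Here the term `k = 0` computes to 0, because `#paths (suc h) 0` is 0.
#paths-convolution (suc h) (suc m) = begin
  convolution (λ k → #paths h k + (#paths (1 + h) k + #paths (2 + h) k)) (#paths 0) m
    ≡⟨ convolution-distribʳ-+ (#paths h) _ (#paths 0) m ⟩
  conv h + convolution (λ k → #paths (1 + h) k + #paths (2 + h) k) (#paths 0) m
    ≡⟨ cong (conv h +_) (convolution-distribʳ-+ (#paths (1 + h)) _ (#paths 0) m) ⟩
  conv h + (conv (1 + h) + conv (2 + h))
    ≡⟨ cong₂ _+_ (#paths-convolution h m)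
         (cong₂ _+_ (#paths-convolution (1 + h) m) (#paths-convolution (2 + h) m)) ⟩
  #paths (1 + h) m + (#paths (2 + h) m + #paths (3 + h) m) ∎
  where
  open ≡-Reasoning
  conv : ℕ → ℕ
  conv i = convolution (#paths i) (#paths 0) m

-- Splitting the paths that begin with an up step at their first return to 0 gives the Motzkin
-- recurrence. It refers to all smaller indices, hence the strong induction.
#paths≡M : ∀ m → #paths 0 m ≡ M m
#paths≡M = <-rec _ λ { zero _ → refl ; (suc m) rec → begin
  #paths 0 m + #paths 1 m
    ≡⟨ cong (#paths 0 m +_) (sym (#paths-convolution 0 m)) ⟩
  #paths 0 m + convolution (#paths 0) (#paths 0) m
    ≡⟨ cong₂ _+_ (rec ≤-refl) (sum-applyUpTo-cong m λ {k} k<m →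
         cong₂ _*_ (rec (<-trans k<m ≤-refl)) (rec (s≤s (m∸n≤m m (suc k))))) ⟩
  M m + convolution M M m
    ≡⟨ sym (M-suc m) ⟩
  M (suc m) ∎ }
  where open ≡-Reasoning

-- Motzkin paths and their heights

data Step : ℕ → ℕ → Set where
  level : ∀ {h} → Step h h
  up    : ∀ {h} → Step h (suc h)
  down  : ∀ {h} → Step (suc h) h

infixr 5 _∷ᵖ_

-- The indices are the starting height and the number of steps; natural numbers as heights keep a
-- path above the axis.
data Path : ℕ → ℕ → Set where
  end  : Path 0 0
  _∷ᵖ_ : ∀ {h h′ m} → Step h h′ → Path h′ m → Path h (suc m)

#paths↔Path : ∀ h m → Fin (#paths h m) ↔ Path h m
#paths↔Path zero    zero    = mk↔ₛ′ (λ _ → end) (λ _ → zero) (λ { end → refl }) (λ { zero → refl })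
#paths↔Path (suc h) zero    = mk↔ₛ′ (λ ()) (λ ()) (λ ()) (λ ())
#paths↔Path zero    (suc m) =
  mk↔ₛ′ (λ { (inj₁ p) → level ∷ᵖ p ; (inj₂ p) → up ∷ᵖ p })
        (λ { (level ∷ᵖ p) → inj₁ p ; (up ∷ᵖ p) → inj₂ p })
        (λ { (level ∷ᵖ p) → refl ; (up ∷ᵖ p) → refl })
        (λ { (inj₁ p) → refl ; (inj₂ p) → refl })
  ↔-∘ ((#paths↔Path 0 m ⊎-↔ #paths↔Path 1 m) ↔-∘ Fin.+↔⊎)
#paths↔Path (suc h) (suc m) =
  mk↔ₛ′ (λ { (inj₁ p) → down ∷ᵖ p ; (inj₂ (inj₁ p)) → level ∷ᵖ p ; (inj₂ (inj₂ p)) → up ∷ᵖ p })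
        (λ { (down ∷ᵖ p) → inj₁ p ; (level ∷ᵖ p) → inj₂ (inj₁ p) ; (up ∷ᵖ p) → inj₂ (inj₂ p) })
        (λ { (down ∷ᵖ p) → refl ; (level ∷ᵖ p) → refl ; (up ∷ᵖ p) → refl })
        (λ { (inj₁ p) → refl ; (inj₂ (inj₁ p)) → refl ; (inj₂ (inj₂ p)) → refl })
  ↔-∘ ((#paths↔Path h m ⊎-↔
          ((#paths↔Path (1 + h) m ⊎-↔ #paths↔Path (2 + h) m) ↔-∘ Fin.+↔⊎)) ↔-∘ Fin.+↔⊎)

height : ∀ {h m} → Path h m → Fin (suc m) → ℕ
height {h} p        zero    = h
height     (s ∷ᵖ p) (suc i) = height p i

Step-irrelevant : ∀ {h h′} (s s′ : Step h h′) → s ≡ s′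
Step-irrelevant level level = refl
Step-irrelevant up    up    = refl
Step-irrelevant down  down  = refl

-- A step is determined by the heights at its two ends.
height-injective : ∀ {h m} (p p′ : Path h m) → (∀ i → height p i ≡ height p′ i) → p ≡ p′
height-injective end      end        _  = refl
height-injective (s ∷ᵖ p) (s′ ∷ᵖ p′) eq with refl ← eq (suc zero) =
  cong₂ _∷ᵖ_ (Step-irrelevant s s′) (height-injective p p′ (eq ∘ suc))

step : ∀ {h h′} → h′ ≤ suc h → h ≤ suc h′ → Step h h′
step {zero}  {zero}        _ _ = level
step {zero}  {suc zero}    _ _ = up
step {zero}  {suc (suc _)} (s≤s ()) _
step {suc zero} {zero}     _ _ = down
step {suc (suc _)} {zero}  _ (s≤s ())
step {suc h} {suc h′}      p q with step (s≤s⁻¹ p) (s≤s⁻¹ q)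
... | level = level
... | up    = up
... | down  = down

-- The path starts at `δ zero` and not at 0, so that the induction can pass to `δ ∘ suc`.
path-through : ∀ m (δ : Fin (suc m) → ℕ) →
  (∀ (i : Fin m) → δ (suc i) ≤ suc (δ (inject₁ i)) × δ (inject₁ i) ≤ suc (δ (suc i))) →
  δ (fromℕ m) ≡ 0 → ∃[ p ] (∀ i → height {δ zero} {m} p i ≡ δ i)
path-through zero    δ near δ₀≡0 = subst (λ h → Path h 0) (sym δ₀≡0) end , λ { zero → refl }
path-through (suc m) δ near δₘ≡0
  with p , eq ← path-through m (δ ∘ suc) (near ∘ suc) δₘ≡0
  = step (proj₁ (near zero)) (proj₂ (near zero)) ∷ᵖ p , λ { zero → refl ; (suc i) → eq i }

Path⇒h≤m : ∀ {h m} → Path h m → h ≤ m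
Path⇒h≤m end          = z≤n
Path⇒h≤m (level ∷ᵖ p) = m≤n⇒m≤1+n (Path⇒h≤m p)
Path⇒h≤m (up    ∷ᵖ p) = m≤n⇒m≤1+n (<⇒≤ (Path⇒h≤m p))
Path⇒h≤m (down  ∷ᵖ p) = s≤s (Path⇒h≤m p)

-- Pairs of chains of subsets following a path

-- A pair of subsets of Fin n, recording for each element whether it belongs to
-- the first and whether it belongs to the second.
Configuration : ℕ → Set
Configuration = Vec (Bool × Bool)

infix 4 _≟ᵇ_ _⊑_

_≟ᵇ_ : DecidableEquality (Bool × Bool)
_≟ᵇ_ = ≡-dec Bool._≟_ Bool._≟_

size : ∀ {n} → (Bool × Bool → Bool) → Configuration n → ℕ
size P c = ∣ map P c ∣

is : Bool × Bool → Bool × Bool → Bool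
is a b = does (a ≟ᵇ b)

both : Bool × Bool → Bool
both (x , y) = x ∧ y

_⊑_ : ∀ {n} → Configuration n → Configuration n → Set
c ⊑ c′ = map proj₁ c ⊆ map proj₁ c′ × map proj₂ c ⊆ map proj₂ c′

⊑-refl : ∀ {n} {c : Configuration n} → c ⊑ c
⊑-refl = ⊆-refl , ⊆-refl

⊑-trans : ∀ {n} {c c′ c″ : Configuration n} → c ⊑ c′ → c′ ⊑ c″ → c ⊑ c″
⊑-trans (p , q) (p′ , q′) = ⊆-trans p p′ , ⊆-trans q q′

∩-projections : ∀ {n} (c : Configuration n) → map proj₁ c ∩ˢ map proj₂ c ≡ map both c
∩-projections []            = refl
∩-projections ((x , y) ∷ c) = cong (x ∧ y ∷_) (∩-projections c)

∷-⊆ : ∀ {n x y} {p q : Subset n} → (x ≡ inside → y ≡ inside) → p ⊆ q → x ∷ p ⊆ y ∷ q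
∷-⊆ x⇒y p⊆q here with refl ← x⇒y refl = here
∷-⊆ x⇒y p⊆q (there i∈p) = there (p⊆q i∈p)

indicator : Bool → ℕ
indicator b = if b then 1 else 0

∣∷∣ : ∀ {n} x (p : Subset n) → ∣ x ∷ p ∣ ≡ indicator x + ∣ p ∣
∣∷∣ true  p = refl
∣∷∣ false p = refl

_≼_ : Bool × Bool → Bool × Bool → Set
(x , y) ≼ (x′ , y′) = (x ≡ true → x′ ≡ true) × (y ≡ true → y′ ≡ true)

-- The first coordinate of type `a` is changed to type `b`. One equation for all `P` updates every
-- size at once, in additive form to avoid subtraction.
replace : ∀ {n k} {a b} (c : Configuration n) → a ≼ b → size (is a) c ≡ suc k →
  ∃[ c′ ] c ⊑ c′ × (∀ P → indicator (P a) + size P c′ ≡ indicator (P b) + size P c)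
replace {a = a} {b} (x ∷ c) a≼b eq with a ≟ᵇ x
... | yes refl = b ∷ c , (∷-⊆ (proj₁ a≼b) ⊆-refl , ∷-⊆ (proj₂ a≼b) ⊆-refl) , λ P → begin
    indicator (P a) + ∣ P b ∷ map P c ∣           ≡⟨ cong (indicator (P a) +_) (∣∷∣ (P b) (map P c)) ⟩
    indicator (P a) + (indicator (P b) + size P c) ≡⟨ x∙yz≈y∙xz (indicator (P a)) (indicator (P b)) (size P c) ⟩
    indicator (P b) + (indicator (P a) + size P c) ≡⟨ cong (indicator (P b) +_) (sym (∣∷∣ (P a) (map P c))) ⟩
    indicator (P b) + ∣ P a ∷ map P c ∣           ∎
  where open ≡-Reasoning
... | no _ with c′ , (⊑₁ , ⊑₂) , sizes ← replace c a≼b eq =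
    x ∷ c′ , (∷-⊆ id ⊑₁ , ∷-⊆ id ⊑₂) , λ P → begin
    indicator (P a) + ∣ P x ∷ map P c′ ∣           ≡⟨ cong (indicator (P a) +_) (∣∷∣ (P x) (map P c′)) ⟩
    indicator (P a) + (indicator (P x) + size P c′) ≡⟨ x∙yz≈y∙xz (indicator (P a)) (indicator (P x)) _ ⟩
    indicator (P x) + (indicator (P a) + size P c′) ≡⟨ cong (indicator (P x) +_) (sizes P) ⟩
    indicator (P x) + (indicator (P b) + size P c) ≡⟨ x∙yz≈y∙xz (indicator (P x)) (indicator (P b)) _ ⟩
    indicator (P b) + (indicator (P x) + size P c) ≡⟨ cong (indicator (P b) +_) (sym (∣∷∣ (P x) (map P c))) ⟩
    indicator (P b) + ∣ P x ∷ map P c ∣           ∎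
  where open ≡-Reasoning

pattern neither = false , false
pattern onlyˡ   = true  , false
pattern onlyʳ   = false , true
pattern shared  = true  , true

-- The two subsets have r elements and are at distance 1 + h.
record Sizes {n} (c : Configuration n) (r h : ℕ) : Set where
  field
    first  : size proj₁ c ≡ r
    second : size proj₂ c ≡ r
    common : size both c + suc h ≡ r

-- m is the number of steps of the path that remain.
record Invariant {n} (c : Configuration n) (h m r : ℕ) : Set where
  field
    -- An up step uses two new coordinates, a level step one and a down step none, so a path of `m`
    -- steps from `h` to 0 uses exactly `m - h`.
    unused  : size (is neither) c + h ≡ m
    onlyˡ#  : size (is onlyˡ) c ≡ suc h
    onlyʳ#  : size (is onlyʳ) c ≡ suc h
    sizes   : Sizes c r h

positive : ∀ a {h m} → a + h ≡ suc m → h ≤ m → ∃[ k ] a ≡ suc k × k + h ≡ m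
positive zero    refl h<h = contradiction h<h 1+n≰n
positive (suc k) eq   _   = k , refl , suc-injective eq

advance : ∀ {n h h′ m r} {c : Configuration n} → Step h h′ → h′ ≤ m →
  Invariant c h (suc m) r → ∃[ c′ ] c ⊑ c′ × Invariant c′ h′ m (suc r)
advance {c = c} level h≤m inv
  with k , eq , k+h≡m ← positive (size (is neither) c) (Invariant.unused inv) h≤m
  with c′ , c⊑c′ , P# ← replace {a = neither} {b = shared} c ((λ _ → refl) , (λ _ → refl)) eq
  = c′ , c⊑c′ , record
    { unused = trans (cong (_+ _) (suc-injective (trans (P# (is neither)) eq))) k+h≡m
    ; onlyˡ# = trans (P# (is onlyˡ)) onlyˡ#
    ; onlyʳ# = trans (P# (is onlyʳ)) onlyʳ#
    ; sizes  = record
      { first  = trans (P# proj₁) (cong suc first)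
      ; second = trans (P# proj₂) (cong suc second)
      ; common = trans (cong (_+ _) (P# both)) (cong suc common)
      }
    }
  where open Invariant inv ; open Sizes sizes
advance {m = suc m} {c = c} up (s≤s h≤m) inv
  with k , eq , k+h≡1+m ← positive (size (is neither) c) (Invariant.unused inv) (m≤n⇒m≤1+n h≤m)
  with c₁ , c⊑c₁ , P#₁ ← replace {a = neither} {b = onlyˡ} c ((λ _ → refl) , (λ ())) eq
  with eq₁ ← suc-injective (trans (P#₁ (is neither)) eq)
  with l , refl , l+h≡m ← positive k k+h≡1+m h≤m
  with c′ , c₁⊑c′ , P# ← replace {a = neither} {b = onlyʳ} c₁ ((λ ()) , (λ _ → refl)) eq₁
  = c′ , ⊑-trans c⊑c₁ c₁⊑c′ , record
    { unused = trans (cong (_+ _) (suc-injective (trans (P# (is neither)) eq₁)))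
                 (trans (+-suc l _) (cong suc l+h≡m))
    ; onlyˡ# = trans (P# (is onlyˡ)) (trans (P#₁ (is onlyˡ)) (cong suc onlyˡ#))
    ; onlyʳ# = trans (P# (is onlyʳ)) (cong suc (trans (P#₁ (is onlyʳ)) onlyʳ#))
    ; sizes  = record
      { first  = trans (P# proj₁) (trans (P#₁ proj₁) (cong suc first))
      ; second = trans (P# proj₂) (cong suc (trans (P#₁ proj₂) second))
      ; common = trans (cong (_+ _) (trans (P# both) (P#₁ both)))
                   (trans (+-suc (size both c) _) (cong suc common))
      }
    }
  where open Invariant inv ; open Sizes sizes
advance {c = c} down h≤m inv
  with c₁ , c⊑c₁ , P#₁ ← replace {a = onlyˡ} {b = shared} c ((λ _ → refl) , (λ ())) (Invariant.onlyˡ# inv)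
  with eq₁ ← trans (P#₁ (is onlyʳ)) (Invariant.onlyʳ# inv)
  with c′ , c₁⊑c′ , P# ← replace {a = onlyʳ} {b = shared} c₁ ((λ _ → refl) , (λ _ → refl)) eq₁
  = c′ , ⊑-trans c⊑c₁ c₁⊑c′ , record
    { unused = trans (cong (_+ _) (trans (P# (is neither)) (P#₁ (is neither))))
                 (suc-injective (trans (sym (+-suc (size (is neither) c) _)) unused))
    ; onlyˡ# = trans (P# (is onlyˡ)) (suc-injective (trans (P#₁ (is onlyˡ)) onlyˡ#))
    ; onlyʳ# = suc-injective (trans (P# (is onlyʳ)) eq₁)
    ; sizes  = record
      { first  = trans (P# proj₁) (cong suc (suc-injective (trans (P#₁ proj₁) (cong suc first))))
      ; second = suc-injective (trans (P# proj₂) (cong suc (trans (P#₁ proj₂) (cong suc second))))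
      ; common = trans (cong (_+ _) (trans (P# both) (cong suc (P#₁ both))))
                   (cong suc (trans (sym (+-suc (size both c) _)) common))
      }
    }
  where open Invariant inv ; open Sizes sizes

-- `above` strengthens the induction: it lets `follow` compare a prepended configuration with all
-- later ones.
record Trajectory {n h m} (c : Configuration n) (p : Path h m) (r : ℕ) : Set where
  field
    configuration : Fin (suc m) → Configuration n
    above         : ∀ i → c ⊑ configuration i
    monotone      : ∀ {i j} → toℕ i ≤ toℕ j → configuration i ⊑ configuration j
    sizes         : ∀ i → Sizes (configuration i) (r + toℕ i) (height p i)

follow : ∀ {n h m r} {c : Configuration n} (p : Path h m) → Invariant c h m r → Trajectory c p r
follow {r = r} {c} end inv = record
  { configuration = λ _ → c
  ; above         = λ _ → ⊑-refl
  ; monotone      = λ _ → ⊑-refl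
  ; sizes         = λ { zero → subst (λ r → Sizes c r 0) (sym (+-identityʳ r)) (Invariant.sizes inv) }
  }
follow {h = h} {r = r} {c} (s ∷ᵖ p) inv
  with c′ , c⊑c′ , inv′ ← advance s (Path⇒h≤m p) inv
  = record
  { configuration = λ { zero → c ; (suc i) → configuration i }
  ; above         = λ { zero → ⊑-refl ; (suc i) → ⊑-trans c⊑c′ (above i) }
  ; monotone      = λ
    { {zero}  {zero}  _ → ⊑-refl
    ; {zero}  {suc j} _ → ⊑-trans c⊑c′ (above j)
    ; {suc i} {suc j} (s≤s i≤j) → monotone i≤j
    }
  ; sizes         = λ
    { zero    → subst (λ r → Sizes c r h) (sym (+-identityʳ r)) (Invariant.sizes inv)
    ; (suc i) → subst (λ r → Sizes (configuration i) r (height p i)) (sym (+-suc r (toℕ i))) (sizes i)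
    }
  }
  where open Trajectory (follow p inv′)

-- Two distinct singletons, that is, two different coordinate lines: distance 1, height 0.
initial : ∀ m → Configuration (suc (suc m))
initial m = onlyˡ ∷ onlyʳ ∷ replicate m neither

size-replicate : ∀ P a m → size P (replicate m a) ≡ m * indicator (P a)
size-replicate P a zero    = refl
size-replicate P a (suc m) = trans (∣∷∣ (P a) (map P (replicate m a)))
  (cong (indicator (P a) +_) (size-replicate P a m))

initial-invariant : ∀ m → Invariant (initial m) 0 m 1
initial-invariant m = record
  { unused = trans (+-identityʳ _) (trans (size-replicate (is neither) neither m) (*-identityʳ m))
  ; onlyˡ# = cong suc (none (is onlyˡ) refl)
  ; onlyʳ# = cong suc (none (is onlyʳ) refl)
  ; sizes  = record
    { first  = cong suc (none proj₁ refl)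
    ; second = cong suc (none proj₂ refl)
    ; common = cong (_+ 1) (none both refl)
    }
  }
  where
  none : ∀ P → P neither ≡ false → size P (replicate m neither) ≡ 0
  none P eq = trans (size-replicate P neither m) (trans (cong (λ b → m * indicator b) eq) (*-zeroʳ m))

-- Functions between finite sets

-- Pigeonhole: punching out a missed value would leave an injection into a set with fewer than `a`
-- elements.
injective⇒surjective : ∀ {a b} {f : Fin a → Fin b} → Injective _≡_ _≡_ f → b ≤ a →
  ∀ j → ∃[ i ] f i ≡ j
injective⇒surjective {b = suc b} {f} f-injective b≤a j with Fin.any? (λ i → f i Fin.≟ j)
... | yes f⁻¹j = f⁻¹j
... | no  ∄    = contradiction (Fin.injective⇒≤ avoid-injective) (<⇒≱ b≤a)
  where
  j≢f : ∀ i → j ≢ f i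
  j≢f i j≡fi = ∄ (i , sym j≡fi)
  avoid : Fin _ → Fin b
  avoid i = punchOut (j≢f i)
  avoid-injective : Injective _≡_ _≡_ avoid
  avoid-injective eq = f-injective (Fin.punchOut-injective (j≢f _) (j≢f _) eq)

-- g compares two members i, j of a fibre of f, so that g with a fixed
-- representative j of each fibre embeds the fibre in Fin c.
fibres-≤ : ∀ {a b c} (f : Fin a → Fin b) (g : ∀ {i j} → f i ≡ f j → Fin c) →
  (∀ {i i′ j} (p : f i ≡ f j) (p′ : f i′ ≡ f j) → g p ≡ g p′ → i ≡ i′) → a ≤ b * c
fibres-≤ {a} {b} {c} f g g-injective =
  Fin.injective⇒≤ {f = λ i → code (f i) i refl} (code-injective refl refl)
  where
  Fibre : Fin b → Set
  Fibre x = ∃[ i ] f i ≡ x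

  -- When the fibre is inhabited, the result depends only on the decision, so all members share one
  -- representative.
  representative : ∀ {x} → Dec (Fibre x) → Fibre x → Fibre x
  representative (yes j) _ = j
  representative (no  ∄) i = contradiction i ∄

  difference : ∀ {x} → Dec (Fibre x) → ∀ i → f i ≡ x → Fin c
  difference d i eq = g (trans eq (sym (proj₂ (representative d (i , eq)))))

  difference-injective : ∀ {x} (d : Dec (Fibre x)) {i i′} (eq : f i ≡ x) (eq′ : f i′ ≡ x) →
    difference d i eq ≡ difference d i′ eq′ → i ≡ i′
  difference-injective (yes j) eq eq′ = g-injective _ _
  difference-injective (no  ∄) eq eq′ = contradiction (_ , eq) ∄

  code : ∀ x i → f i ≡ x → Fin (b * c)
  code x i eq = combine x (difference (Fin.any? (λ j → f j Fin.≟ x)) i eq)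

  -- The values `x` and `x′` are variables here, so that their equality can be matched with `refl`.
  code-injective : ∀ {x x′ i i′} (eq : f i ≡ x) (eq′ : f i′ ≡ x′) →
    code x i eq ≡ code x′ i′ eq′ → i ≡ i′
  code-injective {x} {x′} eq eq′ code≡ with refl , diff≡ ← Fin.combine-injective x _ x′ _ code≡ =
    difference-injective (Fin.any? _) eq eq′ diff≡

-- The shift by 1 makes disjointness of the flags the nonnegativity of the path.
distances : ∀ {h m} → Path h m → Vec ℤ (suc m)
distances p = tabulate (λ i → pos (suc (height p i)))

lookup-distances : ∀ {h m} (p : Path h m) i → lookup (distances p) i ≡ pos (suc (height p i))
lookup-distances p = lookup∘tabulate (λ i → pos (suc (height p i)))

distances-injective : ∀ {h m} {p p′ : Path h m} → distances p ≡ distances p′ → p ≡ p′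
distances-injective {p = p} {p′} eq = height-injective p p′ λ i → suc-injective (ℤ.+-injective (begin
  pos (suc (height p i))      ≡⟨ sym (lookup-distances p i) ⟩
  lookup (distances p) i      ≡⟨ cong (λ d → lookup d i) eq ⟩
  lookup (distances p′) i     ≡⟨ lookup-distances p′ i ⟩
  pos (suc (height p′ i))     ∎))
  where open ≡-Reasoning

-- Arithmetic of dimensions and distances

m+n≡o⇒n≡o-m : ∀ {m n o} → m + n ≡ o → pos n ≡ pos o - pos m
m+n≡o⇒n≡o-m {m} {n} refl = sym (begin
  pos (m + n) - pos m ≡⟨ ℤ.m-n≡m⊖n (m + n) m ⟩
  (m + n) ⊖ m         ≡⟨ ℤ.⊖-≥ (m≤m+n m n) ⟩
  pos (m + n ∸ m)     ≡⟨ cong pos (m+n∸m≡n m n) ⟩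
  pos n               ∎)
  where open ≡-Reasoning

m+[1+n]≡o⇒m<o : ∀ {m n o} → m + suc n ≡ o → m < o
m+[1+n]≡o⇒m<o {m} refl = m<m+n m (s≤s z≤n)

-- The dimension of the flag members grows by 1 and that of their intersection by 0, 1 or 2, so the
-- difference moves by at most 1.
near-distances : ∀ {a b r δ δ′} → a + suc δ ≡ r → b + suc δ′ ≡ suc r → a ≤ b → b ≤ suc (suc a) →
  δ′ ≤ suc δ × δ ≤ suc δ′
near-distances {a} {b} {r} {δ} {δ′} a+δ b+δ′ a≤b b≤2+a =
  s≤s⁻¹ (+-cancelˡ-≤ a _ _ (begin
    a + suc δ′        ≤⟨ +-monoˡ-≤ (suc δ′) a≤b ⟩
    b + suc δ′        ≡⟨ b+δ′ ⟩
    suc r             ≡⟨ cong suc (sym a+δ) ⟩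
    suc (a + suc δ)   ≡⟨ sym (+-suc a (suc δ)) ⟩
    a + suc (suc δ)   ∎)) ,
  s≤s⁻¹ (+-cancelˡ-≤ a _ _ (s≤s⁻¹ (begin
    suc (a + suc δ)       ≡⟨ cong suc a+δ ⟩
    suc r                 ≡⟨ sym b+δ′ ⟩
    b + suc δ′            ≤⟨ +-monoˡ-≤ (suc δ′) b≤2+a ⟩
    suc (suc (a + suc δ′)) ≡⟨ cong suc (sym (+-suc a (suc δ′))) ⟩
    suc (a + suc (suc δ′)) ∎)))
  where open ≤-Reasoning

IsPrimePower⇒>1 : ∀ {q} → IsPrimePower q → 1 < q
IsPrimePower⇒>1 (p , k , p-prime , 1≤k , refl) =
  ^-monoʳ-< p (nonTrivial⇒n>1 p {{prime⇒nonTrivial p-prime}}) 1≤k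

-- Passes from numbers of vectors to dimensions.
^-cancelʳ-≤ : ∀ {q a b} → 1 < q → q ^ a ≤ q ^ b → a ≤ b
^-cancelʳ-≤ 1<q qᵃ≤qᵇ = ≮⇒≥ λ b<a → <⇒≱ (^-monoʳ-< _ 1<q b<a) qᵃ≤qᵇ

module FlagProperties {c ℓ₁ ℓ₂ : Level} (F : HeytingField c ℓ₁ ℓ₂) where

  open Flags F

  private
    F-ring : CommutativeRing c ℓ₁
    F-ring = record { isCommutativeRing = HeytingField.isCommutativeRing F }

  module R = CommutativeRing F-ring
  open R using (Carrier; _≈_; 0#; 1#)
  open VectorEquality R.setoid using (_≋_; ≋-sym; ≋-trans)
  open Sum R.+-commutativeMonoid using (sum-cong-≋; ∑-distrib-+; sum-replicate-zero)
    renaming (sum to ΣF)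
  open RingProperties R.ring using (-1*x≈-x; +-cancelʳ; +-cancelˡ; //-rightDividesˡ)
    renaming (x∙y⁻¹≈ε⇒x≈y to x-y≈0⇒x≈y)
  open import Relation.Binary.Reasoning.Setoid R.setoid

  -- Enumerations of the members of a subspace

  -- `index` may inspect the membership proof, from which coordinates are read; `injective` and
  -- `element-index` make its value depend on the vector alone.
  record Enumeration {n} (U : Subspace n) (N : ℕ) : Set (c ⊔ ℓ₁) where
    field
      element       : Fin N → Vector Carrier n
      member        : ∀ i → Member U (element i)
      injective     : ∀ {i j} → element i ≋ element j → i ≡ j
      index         : ∀ {v} → Member U v → Fin N
      element-index : ∀ {v} (v∈U : Member U v) → element (index v∈U) ≋ v

    index-injective : ∀ {v w} (v∈U : Member U v) (w∈U : Member U w) →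
      index v∈U ≡ index w∈U → v ≋ w
    index-injective v∈U w∈U eq j = R.trans (R.sym (element-index v∈U j))
      (R.trans (R.reflexive (cong (λ i → element i j) eq)) (element-index w∈U j))

  open Enumeration

  -- Linear combinations and differences of vectors

  combination-cong : ∀ {n k} {a a′ : Vector Carrier k} (b : Vector (Vector Carrier n) k) →
    a ≋ a′ → combination a b ≋ combination a′ b
  combination-cong b a≋a′ j = sum-cong-≋ (λ i → R.*-congʳ (a≋a′ i))

  combination-+ : ∀ {n k} (a a′ : Vector Carrier k) (b : Vector (Vector Carrier n) k) →
    combination (a +ᵛ a′) b ≋ combination a b +ᵛ combination a′ b
  combination-+ a a′ b j = R.trans (sum-cong-≋ (λ i → R.distribʳ (b i j) (a i) (a′ i)))
    (∑-distrib-+ (λ i → a i R.* b i j) (λ i → a′ i R.* b i j))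

  combination-injective : ∀ {n k} {b : Vector (Vector Carrier n) k} → LinearlyIndependent b →
    ∀ {a a′} → combination a b ≋ combination a′ b → a ≋ a′
  combination-injective {b = b} independent {a} {a′} eq i =
    x-y≈0⇒x≈y (a i) (a′ i) (independent (λ i → a i R.- a′ i) difference≈0 i)
    where
    difference≈0 : combination (λ i → a i R.- a′ i) b ≋ 0ᵛ
    difference≈0 j = +-cancelʳ (combination a′ b j) _ _ (begin
      combination (λ i → a i R.- a′ i) b j R.+ combination a′ b j
        ≈⟨ combination-+ (λ i → a i R.- a′ i) a′ b j ⟨
      combination (λ i → a i R.- a′ i R.+ a′ i) b j
        ≈⟨ combination-cong b (λ i → //-rightDividesˡ (a′ i) (a i)) j ⟩
      combination a b j
        ≈⟨ eq j ⟩
      combination a′ b j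
        ≈⟨ R.+-identityˡ _ ⟨
      0# R.+ combination a′ b j ∎)

  combination-closed : ∀ {n k} (U : Subspace n) (a : Vector Carrier k) {b : Vector (Vector Carrier n) k} →
    (∀ i → Member U (b i)) → Member U (combination a b)
  combination-closed {k = zero}  U a b∈U = 0-closed U
  combination-closed {k = suc k} U a b∈U =
    +-closed U (*-closed U (a zero) (b∈U zero)) (combination-closed U (a ∘ suc) (b∈U ∘ suc))

  infixl 6 _-ᵛ_

  _-ᵛ_ : ∀ {n} → Vector Carrier n → Vector Carrier n → Vector Carrier n
  v -ᵛ w = v +ᵛ (R.- 1#) *ᵛ w

  -ᵛ-closed : ∀ {n} (U : Subspace n) {v w} → Member U v → Member U w → Member U (v -ᵛ w)
  -ᵛ-closed U v∈U w∈U = +-closed U v∈U (*-closed U _ w∈U)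

  -ᵛ-cancelʳ : ∀ {n} {v v′ : Vector Carrier n} w → v -ᵛ w ≋ v′ -ᵛ w → v ≋ v′
  -ᵛ-cancelʳ w eq j = +-cancelʳ ((R.- 1#) R.* w j) _ _ (eq j)

  +ᵛ-cancelˡ : ∀ {n} (v : Vector Carrier n) {w w′} → v +ᵛ w ≋ v +ᵛ w′ → w ≋ w′
  +ᵛ-cancelˡ v eq j = +-cancelˡ (v j) _ _ (eq j)

  -- If `w` and `w′` lie in a subspace, then so does `v -ᵛ v′`; this is how differences are placed
  -- in `U ∩ₛ V`.
  difference-swap : ∀ {n} {v v′ w w′ : Vector Carrier n} → v +ᵛ w ≋ v′ +ᵛ w′ → w′ -ᵛ w ≋ v -ᵛ v′
  difference-swap {v = v} {v′} {w} {w′} eq j = begin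
    w′ j R.+ R.- 1# R.* w j  ≈⟨ R.+-congˡ (-1*x≈-x (w j)) ⟩
    w′ j R.- w j             ≈⟨ +-cancelʳ (w j) _ _ (+-cancelˡ (v′ j) _ _ (begin
      v′ j R.+ (w′ j R.- w j R.+ w j)        ≈⟨ R.+-congˡ (//-rightDividesˡ (w j) (w′ j)) ⟩
      v′ j R.+ w′ j                          ≈⟨ eq j ⟨
      v j R.+ w j                            ≈⟨ R.+-congʳ (//-rightDividesˡ (v′ j) (v j)) ⟨
      v j R.- v′ j R.+ v′ j R.+ w j          ≈⟨ R.+-congʳ (R.+-comm _ _) ⟩
      v′ j R.+ (v j R.- v′ j) R.+ w j        ≈⟨ R.+-assoc _ _ _ ⟩
      v′ j R.+ (v j R.- v′ j R.+ w j)        ∎)) ⟩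
    v j R.- v′ j             ≈⟨ R.+-congˡ (-1*x≈-x (v′ j)) ⟨
    v j R.+ R.- 1# R.* v′ j  ∎

  -- Comparing subspaces by counting

  infix 4 _⊆ₛ_

  _⊆ₛ_ : ∀ {n} → Subspace n → Subspace n → Set (c ⊔ ℓ₁)
  U ⊆ₛ V = ∀ {v} → Member U v → Member V v

  include : ∀ {n} {U V : Subspace n} {a b} → U ⊆ₛ V → Enumeration U a → Enumeration V b → Fin a → Fin b
  include U⊆V u v i = index v (U⊆V (member u i))

  include-injective : ∀ {n} {U V : Subspace n} {a b} (U⊆V : U ⊆ₛ V)
    (u : Enumeration U a) (v : Enumeration V b) → ∀ {i j} →
    include {U = U} {V} U⊆V u v i ≡ include {U = U} {V} U⊆V u v j → i ≡ j
  include-injective U⊆V u v eq = injective u (index-injective v _ _ eq)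

  -- The inclusion is an injection of finite sets, hence onto when the target is not larger.
  reverse-⊆ : ∀ {n} {U V : Subspace n} {a b} → U ⊆ₛ V →
    Enumeration U a → Enumeration V b → b ≤ a → V ⊆ₛ U
  reverse-⊆ {U = U} {V} U⊆V u v b≤a x∈V
    with i , eq ← injective⇒surjective (include-injective {U = U} {V} U⊆V u v) b≤a (index v x∈V)
    = respects U (index-injective v (U⊆V (member u i)) x∈V eq) (member u i)

  -- (x , u , v) ↦ (x + u , x + v) maps (U′ ∩ V′) × U × V to U′ × V′, and two elements
  -- with the same image have first components differing by an element of U ∩ V.
  ∩-index : ∀ {n} {U U′ V V′ : Subspace n} {a a′ b b′ w x} →
    U ⊆ₛ U′ → V ⊆ₛ V′ →
    Enumeration U a → Enumeration U′ a′ → Enumeration V b → Enumeration V′ b′ →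
    Enumeration (U ∩ₛ V) w → Enumeration (U′ ∩ₛ V′) x →
    x * (a * b) ≤ (a′ * b′) * w
  ∩-index {n} {U} {U′} {V} {V′} {a} {a′} {b} {b′} {w} {x} U⊆U′ V⊆V′ eU eU′ eV eV′ eW eX =
    fibres-≤ f (λ p → index eW (differs p)) λ {i} {i′} {j} p p′ eq →
      -- Equal differences from the same `j` give equal first components; the common image under `f`
      -- then determines the other two.
      separates {i} {i′} (trans p (sym p′))
        (injective eX (-ᵛ-cancelʳ (element eX (xᵢ j)) (index-injective eW (differs p) (differs p′) eq)))
    where
    I : Set
    I = Fin (x * (a * b))
    xᵢ : I → Fin x
    xᵢ i = proj₁ (remQuot {x} (a * b) i)
    uvᵢ : I → Fin a × Fin b
    uvᵢ i = remQuot {a} b (proj₂ (remQuot {x} (a * b) i))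
    X U+ V+ : I → Vector Carrier n
    X i = element eX (xᵢ i)
    U+ i = element eU (proj₁ (uvᵢ i))
    V+ i = element eV (proj₂ (uvᵢ i))
    inU′ : ∀ i → Member U′ (X i +ᵛ U+ i)
    inU′ i = +-closed U′ (proj₁ (member eX _)) (U⊆U′ (member eU _))
    inV′ : ∀ i → Member V′ (X i +ᵛ V+ i)
    inV′ i = +-closed V′ (proj₂ (member eX _)) (V⊆V′ (member eV _))
    f : I → Fin (a′ * b′)
    f i = combine (index eU′ (inU′ i)) (index eV′ (inV′ i))
    f-≋ : ∀ {i j} → f i ≡ f j → X i +ᵛ U+ i ≋ X j +ᵛ U+ j × X i +ᵛ V+ i ≋ X j +ᵛ V+ j
    f-≋ eq with eqU , eqV ← Fin.combine-injective _ _ _ _ eq =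
      index-injective eU′ _ _ eqU , index-injective eV′ _ _ eqV
    differs : ∀ {i j} → f i ≡ f j → Member (U ∩ₛ V) (X i -ᵛ X j)
    differs {i} {j} eq =
      respects U (difference-swap (proj₁ (f-≋ {i} {j} eq))) (-ᵛ-closed U (member eU _) (member eU _)) ,
      respects V (difference-swap (proj₂ (f-≋ {i} {j} eq))) (-ᵛ-closed V (member eV _) (member eV _))
    separates : ∀ {i i′} → f i ≡ f i′ → xᵢ i ≡ xᵢ i′ → i ≡ i′
    separates {i} {i′} eq x≡ =
      trans (sym (recombine i)) (trans (cong₂ combine x≡ (cong₂ combine U≡ V≡)) (recombine i′))
      where
      U≡ : proj₁ (uvᵢ i) ≡ proj₁ (uvᵢ i′)
      U≡ = injective eU (+ᵛ-cancelˡ (X i) λ j → R.trans (proj₁ (f-≋ {i} {i′} eq) j)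
             (R.+-congʳ (R.reflexive (cong (λ k → element eX k j) (sym x≡)))))
      V≡ : proj₂ (uvᵢ i) ≡ proj₂ (uvᵢ i′)
      V≡ = injective eV (+ᵛ-cancelˡ (X i) λ j → R.trans (proj₂ (f-≋ {i} {i′} eq) j)
             (R.+-congʳ (R.reflexive (cong (λ k → element eX k j) (sym x≡)))))
      recombine : ∀ i → combine (xᵢ i) (combine (proj₁ (uvᵢ i)) (proj₂ (uvᵢ i))) ≡ i
      recombine i = trans (cong (combine (xᵢ i)) (Fin.combine-remQuot {a} b _))
        (Fin.combine-remQuot {x} (a * b) i)

  HasDimension-resp : ∀ {n k} {U V : Subspace n} → U ⊆ₛ V → V ⊆ₛ U →
    HasDimension U k → HasDimension V k
  HasDimension-resp U⊆V V⊆U (b , basis) = b , record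
    { members     = λ i → U⊆V (members i)
    ; independent = independent
    ; spanning    = λ v∈V → spanning (V⊆U v∈V)
    }
    where open IsBasis basis

  -- Coordinate subspaces

  -- `Lift` only raises the vanishing condition to the universe level of `Member`.
  Coordinate : ∀ {n} → Subset n → Subspace n
  Coordinate s = record
    { Member   = λ v → Lift c (∀ j → j ∉ s → v j ≈ 0#)
    ; respects = λ v≋w v∈ → lift λ j j∉s → R.trans (R.sym (v≋w j)) (lower v∈ j j∉s)
    ; 0-closed = lift λ _ _ → R.refl
    ; +-closed = λ v∈ w∈ → lift λ j j∉s →
        R.trans (R.+-cong (lower v∈ j j∉s) (lower w∈ j j∉s)) (R.+-identityˡ 0#)
    ; *-closed = λ a v∈ → lift λ j j∉s → R.trans (R.*-congˡ (lower v∈ j j∉s)) (R.zeroʳ a)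
    }

  Coordinate-mono : ∀ {n} {s t : Subset n} → s ⊆ t → Coordinate s ⊆ₛ Coordinate t
  Coordinate-mono s⊆t v∈ = lift λ j j∉t → lower v∈ j (j∉t ∘ s⊆t)

  Coordinate-∩ : ∀ {n} (s t : Subset n) {k} →
    HasDimension (Coordinate (s ∩ˢ t)) k → HasDimension (Coordinate s ∩ₛ Coordinate t) k
  Coordinate-∩ s t = HasDimension-resp {U = Coordinate (s ∩ˢ t)} {Coordinate s ∩ₛ Coordinate t}
    (λ v∈ → Coordinate-mono (proj₁ ∘ x∈p∩q⁻ s t) v∈ , Coordinate-mono (proj₂ ∘ x∈p∩q⁻ s t) v∈)
    λ (v∈s , v∈t) → lift λ j j∉s∩t → vanish v∈s v∈t j j∉s∩t
    where
    vanish : ∀ {v} → Member (Coordinate s) v → Member (Coordinate t) v → ∀ j → j ∉ s ∩ˢ t → v j ≈ 0#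
    vanish v∈s v∈t j j∉s∩t with j ∈? s
    ... | yes j∈s = lower v∈t j λ j∈t → j∉s∩t (x∈p∩q⁺ (j∈s , j∈t))
    ... | no  j∉s = lower v∈s j j∉s

  unitVectors : ∀ {n} (s : Subset n) → Vector (Vector Carrier n) ∣ s ∣
  unitVectors (outside ∷ s) i       zero    = 0#
  unitVectors (outside ∷ s) i       (suc j) = unitVectors s i j
  unitVectors (inside  ∷ s) zero    zero    = 1#
  unitVectors (inside  ∷ s) zero    (suc j) = 0#
  unitVectors (inside  ∷ s) (suc i) zero    = 0#
  unitVectors (inside  ∷ s) (suc i) (suc j) = unitVectors s i j

  coordinates : ∀ {n} (s : Subset n) → Vector Carrier n → Vector Carrier ∣ s ∣
  coordinates (outside ∷ s) v i       = coordinates s (v ∘ suc) i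
  coordinates (inside  ∷ s) v zero    = v zero
  coordinates (inside  ∷ s) v (suc i) = coordinates s (v ∘ suc) i

  Σ*0≈0 : ∀ {k} (a : Vector Carrier k) → ΣF (λ i → a i R.* 0#) ≈ 0#
  Σ*0≈0 {k} a = R.trans (sum-cong-≋ (λ i → R.zeroʳ (a i))) (sum-replicate-zero k)

  inside-zero : ∀ {n} (s : Subset n) a → combination a (unitVectors (inside ∷ s)) zero ≈ a zero
  inside-zero s a = R.trans (R.+-cong (R.*-identityʳ _) (Σ*0≈0 (a ∘ suc))) (R.+-identityʳ _)

  inside-suc : ∀ {n} (s : Subset n) a j →
    combination a (unitVectors (inside ∷ s)) (suc j) ≈ combination (a ∘ suc) (unitVectors s) j
  inside-suc s a j = R.trans (R.+-congʳ (R.zeroʳ _)) (R.+-identityˡ _)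

  unitVectors-members : ∀ {n} (s : Subset n) i j → j ∉ s → unitVectors s i j ≈ 0#
  unitVectors-members (outside ∷ s) i       zero    j∉s = R.refl
  unitVectors-members (outside ∷ s) i       (suc j) j∉s = unitVectors-members s i j (j∉s ∘ there)
  unitVectors-members (inside  ∷ s) zero    zero    j∉s = contradiction here j∉s
  unitVectors-members (inside  ∷ s) zero    (suc j) j∉s = R.refl
  unitVectors-members (inside  ∷ s) (suc i) zero    j∉s = R.refl
  unitVectors-members (inside  ∷ s) (suc i) (suc j) j∉s = unitVectors-members s i j (j∉s ∘ there)

  unitVectors-independent : ∀ {n} (s : Subset n) → LinearlyIndependent (unitVectors s)
  unitVectors-independent (outside ∷ s) a eq i       = unitVectors-independent s a (eq ∘ suc) i
  unitVectors-independent (inside  ∷ s) a eq zero    = R.trans (R.sym (inside-zero s a)) (eq zero)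
  unitVectors-independent (inside  ∷ s) a eq (suc i) = unitVectors-independent s (a ∘ suc)
    (λ j → R.trans (R.sym (inside-suc s a j)) (eq (suc j))) i

  unitVectors-spanning : ∀ {n} (s : Subset n) v → (∀ j → j ∉ s → v j ≈ 0#) →
    v ≋ combination (coordinates s v) (unitVectors s)
  unitVectors-spanning (outside ∷ s) v v∈ zero    =
    R.trans (v∈ zero λ ()) (R.sym (Σ*0≈0 (coordinates s (v ∘ suc))))
  unitVectors-spanning (outside ∷ s) v v∈ (suc j) =
    unitVectors-spanning s (v ∘ suc) (λ j j∉s → v∈ (suc j) λ { (there j∈s) → j∉s j∈s }) j
  unitVectors-spanning (inside  ∷ s) v v∈ zero    = R.sym (inside-zero s (coordinates (inside ∷ s) v))
  unitVectors-spanning (inside  ∷ s) v v∈ (suc j) = R.trans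
    (unitVectors-spanning s (v ∘ suc) (λ j j∉s → v∈ (suc j) λ { (there j∈s) → j∉s j∈s }) j)
    (R.sym (inside-suc s (coordinates (inside ∷ s) v) j))

  Coordinate-dimension : ∀ {n} (s : Subset n) → HasDimension (Coordinate s) ∣ s ∣
  Coordinate-dimension s = unitVectors s , record
    { members     = λ i → lift (unitVectors-members s i)
    ; independent = unitVectors-independent s
    ; spanning    = λ {v} v∈ → coordinates s v , unitVectors-spanning s v (lower v∈)
    }

  -- Dimensions over a finite field

  module Finite {q : ℕ} (F↔q : HasCardinality R.setoid q) (1<q : 1 < q) where

    private
      scalar : Fin q → Carrier
      scalar = Bijection.to F↔q

      scalar⁻¹ : Carrier → Fin q
      scalar⁻¹ = Bijection.to⁻ F↔q

      scalar-scalar⁻¹ : ∀ a → scalar (scalar⁻¹ a) ≈ a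
      scalar-scalar⁻¹ a = proj₂ (Bijection.strictlySurjective F↔q a)

    funToFin-cong : ∀ {k} {f g : Fin k → Fin q} → (∀ i → f i ≡ g i) → funToFin f ≡ funToFin g
    funToFin-cong {zero}  f≗g = refl
    funToFin-cong {suc k} f≗g = cong₂ combine (f≗g zero) (funToFin-cong (f≗g ∘ suc))

    -- Vectors correspond to coefficient tuples, which `funToFin` encodes as numbers below `q ^ k`;
    -- independence gives injectivity, spanning gives the index.
    enumerate : ∀ {n k} {U : Subspace n} → HasDimension U k → Enumeration U (q ^ k)
    enumerate {k = k} {U} (b , basis) = record
      { element       = λ i → combination (scalar ∘ finToFun i) b
      ; member        = λ i → combination-closed U (scalar ∘ finToFun i) members
      ; injective     = λ {i} {j} eq → trans (sym (Fin.funToFin-finToFin {k} {q} i))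
          (trans (funToFin-cong (λ l → Bijection.injective F↔q (combination-injective independent eq l)))
                 (Fin.funToFin-finToFin {k} {q} j))
      ; index         = λ v∈U → funToFin (scalar⁻¹ ∘ proj₁ (spanning v∈U))
      ; element-index = λ v∈U → ≋-trans
          (combination-cong b λ l → R.trans
            (R.reflexive (cong scalar (Fin.finToFun-funToFin (scalar⁻¹ ∘ proj₁ (spanning v∈U)) l)))
            (scalar-scalar⁻¹ _))
          (≋-sym (proj₂ (spanning v∈U)))
      }
      where open IsBasis basis

    -- Counting gives `q ^ k ≤ q ^ l`, in place of an exchange argument.
    dimension-mono : ∀ {n k l} {U V : Subspace n} → U ⊆ₛ V →
      HasDimension U k → HasDimension V l → k ≤ l
    dimension-mono {U = U} {V} U⊆V dimU dimV = ^-cancelʳ-≤ 1<q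
      (Fin.injective⇒≤ (include-injective {U = U} {V} U⊆V
        (enumerate {U = U} dimU) (enumerate {U = V} dimV)))

    dimension-≥⇒⊇ : ∀ {n k l} {U V : Subspace n} → U ⊆ₛ V →
      HasDimension U k → HasDimension V l → l ≤ k → V ⊆ₛ U
    dimension-≥⇒⊇ {U = U} {V} U⊆V dimU dimV l≤k =
      reverse-⊆ {U = U} {V} U⊆V (enumerate {U = U} dimU) (enumerate {U = V} dimV)
        (^-monoʳ-≤ q {{>-nonZero (<-trans (s≤s z≤n) 1<q)}} l≤k)

    -- By `∩-index` the exponents satisfy `m′ + 2k ≤ 2(k + 1) + m`, and `2k` cancels.
    dimension-∩-≤ : ∀ {n k m m′} {U U′ V V′ : Subspace n} → U ⊆ₛ U′ → V ⊆ₛ V′ →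
      HasDimension U k → HasDimension U′ (suc k) → HasDimension V k → HasDimension V′ (suc k) →
      HasDimension (U ∩ₛ V) m → HasDimension (U′ ∩ₛ V′) m′ → m′ ≤ suc (suc m)
    dimension-∩-≤ {k = k} {m} {m′} {U} {U′} {V} {V′} U⊆U′ V⊆V′ dU dU′ dV dV′ dW dX =
      +-cancelʳ-≤ (k + k) m′ (suc (suc m)) (subst (m′ + (k + k) ≤_) rearrange
        (^-cancelʳ-≤ 1<q (subst₂ _≤_ (sym lhs) (sym rhs)
          (∩-index {U = U} {U′} {V} {V′} U⊆U′ V⊆V′ (enumerate {U = U} dU) (enumerate {U = U′} dU′)
            (enumerate {U = V} dV) (enumerate {U = V′} dV′)
            (enumerate {U = U ∩ₛ V} dW) (enumerate {U = U′ ∩ₛ V′} dX)))))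
      where
      lhs : q ^ (m′ + (k + k)) ≡ q ^ m′ * (q ^ k * q ^ k)
      lhs = trans (^-distribˡ-+-* q m′ (k + k)) (cong (q ^ m′ *_) (^-distribˡ-+-* q k k))
      rhs : q ^ (suc k + suc k + m) ≡ q ^ suc k * q ^ suc k * q ^ m
      rhs = trans (^-distribˡ-+-* q (suc k + suc k) m)
        (cong (_* q ^ m) (^-distribˡ-+-* q (suc k) (suc k)))
      rearrange : suc k + suc k + m ≡ suc (suc m) + (k + k)
      rearrange = trans (cong (_+ m) (+-suc (suc k) k)) (cong (λ i → suc (suc i)) (+-comm (k + k) m))

    -- An intersection of dimension at least `k` would fill both subspaces and make them equal.
    dimension-∩-< : ∀ {n k m} {U V : Subspace n} → ¬ (U ≈ₛ V) →
      HasDimension U k → HasDimension V k → HasDimension (U ∩ₛ V) m → m < k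
    dimension-∩-< {U = U} {V} U≉V dU dV dW = ≰⇒> λ k≤m → U≉V
      ( (λ v∈U → proj₂ (dimension-≥⇒⊇ {U = U ∩ₛ V} {U} proj₁ dW dU k≤m v∈U))
      , (λ v∈V → proj₁ (dimension-≥⇒⊇ {U = U ∩ₛ V} {V} proj₂ dW dV k≤m v∈V)) )

    -- Coordinate flags realising a path

    coordinateFlag : ∀ {m} (s : Fin (suc m) → Subset (suc (suc m))) →
      (∀ {i j} → toℕ i ≤ toℕ j → s i ⊆ s j) → (∀ i → ∣ s i ∣ ≡ suc (toℕ i)) → Flag (suc (suc m))
    coordinateFlag s s-mono ∣s∣ = record
      { space     = Coordinate ∘ s
      ; chain     = λ {i} {j} i<j →
          Coordinate-mono (s-mono (<⇒≤ i<j)) , λ sⱼ⊆sᵢ →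
          <⇒≱ i<j (s≤s⁻¹ (dimension-mono {U = Coordinate (s j)} {Coordinate (s i)} sⱼ⊆sᵢ (dim j) (dim i)))
      ; dimension = dim
      }
      where
      dim : ∀ i → HasDimension (Coordinate (s i)) (suc (toℕ i))
      dim i = subst (HasDimension (Coordinate (s i))) (∣s∣ i) (Coordinate-dimension (s i))

    realise : ∀ {m} (p : Path 0 m) → IsDisjointDistanceVector (suc (suc m)) (distances p)
    -- The flags differ as wholes because they already differ at index `zero`.
    realise {m} p = 𝓕 , 𝓖 , ((λ 𝓕≈𝓖 → disjoint zero (𝓕≈𝓖 zero)) , disjoint) , λ i →
      size both (configuration i) , dim-∩ i ,
      trans (lookup-distances p i) (m+n≡o⇒n≡o-m {size both (configuration i)} (Sizes.common (sizes i)))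
      where
      open Trajectory (follow p (initial-invariant m))
      𝓕 𝓖 : Flag (suc (suc m))
      𝓕 = coordinateFlag (map proj₁ ∘ configuration) (λ i≤j → proj₁ (monotone i≤j)) (Sizes.first ∘ sizes)
      𝓖 = coordinateFlag (map proj₂ ∘ configuration) (λ i≤j → proj₂ (monotone i≤j)) (Sizes.second ∘ sizes)
      dim-∩ : ∀ i → HasDimension (space 𝓕 i ∩ₛ space 𝓖 i) (size both (configuration i))
      dim-∩ i = Coordinate-∩ (map proj₁ (configuration i)) (map proj₂ (configuration i))
        (subst (λ s → HasDimension (Coordinate s) (size both (configuration i)))
          (sym (∩-projections (configuration i))) (Coordinate-dimension (map both (configuration i))))
      disjoint : ∀ i → ¬ (space 𝓕 i ≈ₛ space 𝓖 i)
      -- An inclusion would force the intersection to have full dimension, but `common` leaves it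
      -- short by `suc (height p i)`.
      disjoint i (𝓕⊆𝓖 , _) = <⇒≱
        (m+[1+n]≡o⇒m<o (Sizes.common (sizes i)))
        (dimension-mono {U = space 𝓕 i} {space 𝓕 i ∩ₛ space 𝓖 i}
          (λ v∈𝓕 → v∈𝓕 , 𝓕⊆𝓖 v∈𝓕) (dimension 𝓕 i) (dim-∩ i))

    -- The path of two disjoint flags

    everything : ∀ {n} → Subspace n
    everything = Coordinate ⊤

    everything-maximal : ∀ {n} (U : Subspace n) → U ⊆ₛ everything
    everything-maximal U _ = lift λ j j∉⊤ → contradiction ∈⊤ j∉⊤

    everything-dimension : ∀ {n} → HasDimension (everything {n}) n
    everything-dimension {n} = subst (HasDimension everything) (∣⊤∣≡n n) (Coordinate-dimension ⊤)

    follows-path : ∀ {m d} → IsDisjointDistanceVector (suc (suc m)) d →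
      ∃[ p ] (distances {0} {m} p ≡ d)
    follows-path {m} {d} (𝓕 , 𝓖 , (_ , disjoint) , distance) =
      let p , height≡ = path-through m δ near δ-last in
      p′ p , trans
        (tabulate-cong λ i →
          trans (cong (λ h → pos (suc h)) (trans (height-p′ p i) (height≡ i))) (sym (d≡ i)))
        (tabulate∘lookup d)
      where
      ι δ : Fin (suc m) → ℕ
      ι i = proj₁ (distance i)
      -- The distance minus 1, as the dimension is `suc (toℕ i)`; `ι+δ` shows by disjointness that
      -- nothing is truncated.
      δ i = toℕ i ∸ ι i
      dim-∩ : ∀ i → HasDimension (space 𝓕 i ∩ₛ space 𝓖 i) (ι i)
      dim-∩ i = proj₁ (proj₂ (distance i))
      ι+δ : ∀ i → ι i + suc (δ i) ≡ suc (toℕ i)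
      ι+δ i = trans (+-suc (ι i) (δ i)) (cong suc (m+[n∸m]≡n (s≤s⁻¹
        (dimension-∩-< {U = space 𝓕 i} {space 𝓖 i} (disjoint i) (dimension 𝓕 i) (dimension 𝓖 i) (dim-∩ i)))))
      d≡ : ∀ i → lookup d i ≡ pos (suc (δ i))
      d≡ i = trans (proj₂ (proj₂ (distance i))) (sym (m+n≡o⇒n≡o-m (ι+δ i)))
      δ₀≡0 : δ zero ≡ 0
      δ₀≡0 = 0∸n≡0 (ι zero)
      -- `0 ∸ ι zero` does not compute to 0 while `ι zero` is unknown, so the start is transported.
      p′ : Path (δ zero) m → Path 0 m
      p′ = subst (λ h → Path h m) δ₀≡0
      height-p′ : ∀ p i → height (p′ p) i ≡ height p i
      height-p′ p i rewrite δ₀≡0 = refl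
      dim : ∀ (𝓗 : Flag (suc (suc m))) (i : Fin m) → HasDimension (space 𝓗 (inject₁ i)) (suc (toℕ i))
      dim 𝓗 i = subst (λ k → HasDimension (space 𝓗 (inject₁ i)) (suc k))
        (Fin.toℕ-inject₁ i) (dimension 𝓗 (inject₁ i))
      i<1+i : ∀ (i : Fin m) → toℕ (inject₁ i) < suc (toℕ i)
      i<1+i i = s≤s (≤-reflexive (Fin.toℕ-inject₁ i))
      near : ∀ (i : Fin m) → δ (suc i) ≤ suc (δ (inject₁ i)) × δ (inject₁ i) ≤ suc (δ (suc i))
      near i = near-distances (trans (ι+δ (inject₁ i)) (cong suc (Fin.toℕ-inject₁ i))) (ι+δ (suc i))
        (dimension-mono {U = space 𝓕 (inject₁ i) ∩ₛ space 𝓖 (inject₁ i)} {space 𝓕 (suc i) ∩ₛ space 𝓖 (suc i)}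
          (λ (v∈𝓕 , v∈𝓖) → proj₁ (chain 𝓕 (i<1+i i)) v∈𝓕 , proj₁ (chain 𝓖 (i<1+i i)) v∈𝓖)
          (dim-∩ (inject₁ i)) (dim-∩ (suc i)))
        (dimension-∩-≤ {U = space 𝓕 (inject₁ i)} {space 𝓕 (suc i)} {space 𝓖 (inject₁ i)} {space 𝓖 (suc i)}
          (proj₁ (chain 𝓕 (i<1+i i))) (proj₁ (chain 𝓖 (i<1+i i)))
          (dim 𝓕 i) (dimension 𝓕 (suc i)) (dim 𝓖 i) (dimension 𝓖 (suc i))
          (dim-∩ (inject₁ i)) (dim-∩ (suc i)))
      last : Fin (suc m)
      last = fromℕ m
      dim-last : ∀ (𝓗 : Flag (suc (suc m))) → HasDimension (space 𝓗 last) (suc m)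
      dim-last 𝓗 = subst (λ k → HasDimension (space 𝓗 last) (suc k))
        (Fin.toℕ-fromℕ m) (dimension 𝓗 last)
      -- The hyperplanes of the two flags are compared inside the whole space, whose
      -- intersection with itself has dimension 2 + m.
      m≤ι-last : m ≤ ι last
      m≤ι-last = s≤s⁻¹ (s≤s⁻¹ (dimension-∩-≤ {U = space 𝓕 last} {everything} {space 𝓖 last} {everything}
        (everything-maximal (space 𝓕 last)) (everything-maximal (space 𝓖 last))
        (dim-last 𝓕) everything-dimension (dim-last 𝓖) everything-dimension (dim-∩ last)
        (HasDimension-resp {U = everything} {everything ∩ₛ everything}
          (λ v∈ → v∈ , v∈) proj₁ everything-dimension)))
      δ-last : δ last ≡ 0
      δ-last = m≤n⇒m∸n≡0 (≤-trans (≤-reflexive (Fin.toℕ-fromℕ m)) m≤ι-last)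

    -- The bijection with Motzkin paths

    disjointDistanceVectors-cardinality : ∀ m → HasCardinality (disjointDistanceVectors (suc (suc m))) (M m)
    disjointDistanceVectors-cardinality m =
      subst (HasCardinality (disjointDistanceVectors (suc (suc m)))) (#paths≡M m) record
        -- Equality in the target compares the vectors only, so the choice of flags in `realise`
        -- does not affect injectivity or surjectivity.
        { to        = λ i → distances (to i) , realise (to i)
        ; cong      = cong (distances ∘ to)
        ; bijective = (λ eq → injective-↔ (distances-injective eq)) , λ (d , d-realised) →
            let p , eq = follows-path d-realised in
            from p , λ { refl → trans (cong distances (strictlyInverseˡ p)) eq }
        }
      where
      open Inverse (#paths↔Path 0 m) using (to; from; strictlyInverseˡ; strictlyInverseʳ)
      injective-↔ : ∀ {i j} → to i ≡ to j → i ≡ j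
      injective-↔ {i} {j} eq = trans (sym (strictlyInverseʳ i)) (trans (cong from eq) (strictlyInverseʳ j))

corollary4p7 : {c ℓ₁ ℓ₂ : Level} (q : ℕ) → IsPrimePower q →
    (F : HeytingField c ℓ₁ ℓ₂) → HasCardinality (HeytingField.setoid F) q →
    (n : ℕ) → 2 ≤ n →
    HasCardinality (Flags.disjointDistanceVectors F n) (E n) × E n ≡ M (n ∸ 2)
-- At `n = 2 + m` both `E n` and `M (n ∸ 2)` reduce to `M m`.
corollary4p7 q q-primePower F F↔q (suc (suc m)) (s≤s (s≤s z≤n)) =
  disjointDistanceVectors-cardinality m , refl
  where open FlagProperties.Finite F F↔q (IsPrimePower⇒>1 q-primePower)
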